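{- Let $f(x)\in\mathbb{Z}[x]$ be monic with $\deg f(x)=n>m$, where $m$ is a positive integer, and let $q_1,\dots,q_m\in\mathbb{Z}$. Then the equation $$(y+q_1)(y+q_2)\cdots(y+q_m)=f(x)$$ has finitely many solutions $(x,y)$ in integers if and only if $|x-y|$ is bounded for all integer solutions $(x,y)$, i.e. there is a constant $C$ such that $|x-y|\le C$ for every integer solution $(x,y)$ of the equation. -}

module Defs where

open import Data.Integer.Base using (ℤ; _+_; _*_; 0ℤ; 1ℤ)
open import Data.List.Base using (List; []; _∷_)
open import Data.List.Membership.Propositional using (_∈_)
open import Data.Nat.Base using (ℕ; zero; suc; _<_)
open import Data.Product.Base using (∃-syntax; _×_; _,_)
open import Data.Vec.Functional using (Vector; foldr)
open import Relation.Binary.PropositionalEquality using (_≡_; _≢_)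
open import Relation.Unary using (Pred; _≐_)
open import Level using (Level)

private
  variable
    a ℓ : Level

-- Coefficient lists, constant term first.  Trailing zeros are allowed, so
-- the degree is not determined by the length of the list.
ℤ[x] : Set
ℤ[x] = List ℤ

coeff : ℤ[x] → ℕ → ℤ
coeff []      _       = 0ℤ
coeff (c ∷ _) zero    = c
coeff (_ ∷ p) (suc k) = coeff p k

eval : ℤ[x] → ℤ → ℤ
eval []      x = 0ℤ
eval (c ∷ p) x = c + x * eval p x

-- A relation rather than a function, so that the zero polynomial has no
-- degree.
HasDegree : ℤ[x] → ℕ → Set
HasDegree p n = coeff p n ≢ 0ℤ × (∀ k → n < k → coeff p k ≡ 0ℤ)

Monic : ℤ[x] → Set
Monic p = ∃[ n ] (HasDegree p n × coeff p n ≡ 1ℤ)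

product : ∀ {m} → Vector ℤ m → ℤ
product = foldr _*_ 1ℤ

-- The list may contain repetitions; it must have exactly the elements of P.
Finite : {A : Set a} → Pred A ℓ → Set _
Finite P = ∃[ xs ] (P ≐ (_∈ xs))

Solution : ∀ {m} → Vector ℤ m → ℤ[x] → Pred (ℤ × ℤ) _
Solution q f (x , y) = product (λ i → y + q i) ≡ eval f x

{-# OPTIONS --safe #-}
-- Only finitely many differences d = y - x are allowed when |x - y| is bounded.
-- For a fixed d the equation says that x is a root of f(X) - ∏ (X + (d + qᵢ)),
-- which is nonzero because its coefficient of degree n > m is that of f.
-- A nonzero integer polynomial has finitely many integer roots, since a nonzero
-- root divides the lowest nonzero coefficient.
module Submission where

open import Defs
open import Data.Fin.Base using (zero; suc)
open import Data.Integer.Base using (ℤ; +_; -[1+_]; 0ℤ; 1ℤ; -1ℤ; _+_; _*_; -_; _-_; ∣_∣; ≢-nonZero)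
open import Data.Integer.Properties
  using (+-0-abelianGroup; _≟_; +-identityˡ; +-identityʳ; *-zeroʳ; abs-*;
         ∣-i∣≡∣i∣; ∣i-j∣≡∣j-i∣; i*j≡0⇒i≡0∨j≡0)
open import Data.Integer.Tactic.RingSolver using (solve-∀)
open import Data.List.Base using (List; []; _∷_; _++_; map; upTo; concatMap; filter)
open import Data.List.Extrema.Nat using (max; xs≤max)
open import Data.List.Membership.Propositional using (_∈_; lose)
open import Data.List.Membership.Propositional.Properties
  using (∈-map⁺; ∈-upTo⁺; ∈-++⁺ˡ; ∈-++⁺ʳ; ∈-concatMap⁺; ∈-filter⁺; ∈-filter⁻)
open import Data.List.Relation.Unary.All using (lookup)
open import Data.List.Relation.Unary.Any using (here; there)
open import Data.Nat.Base as ℕ using (ℕ; zero; suc; _<_; _≤_; s≤s; s<s⁻¹)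
open import Data.Nat.Divisibility using (∣⇒≤; m∣m*n; _∣_)
open import Data.Nat.Properties using (m<n⇒m<1+n)
open import Data.Product.Base using (∃-syntax; _×_; _,_; proj₁; proj₂)
open import Data.Sum.Base using (inj₁; inj₂)
open import Data.Vec.Functional using (Vector; tail)
open import Algebra.Properties.AbelianGroup +-0-abelianGroup using (inverseˡ-unique)
open import Function.Base using (_∘_)
open import Function.Bundles using (_⇔_; mk⇔)
open import Relation.Binary.PropositionalEquality
open import Relation.Nullary.Decidable using (yes; no)
open import Relation.Unary using (Pred; _⊆_; Decidable)

open ≡-Reasoning

interval : ℕ → List ℤ
interval N = map +_ (upTo (suc N)) ++ map (-_ ∘ +_) (upTo (suc N))

∈-interval : ∀ {N} i → ∣ i ∣ ≤ N → i ∈ interval N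
∈-interval     (+ k)    k≤N = ∈-++⁺ˡ (∈-map⁺ +_ (∈-upTo⁺ (s≤s k≤N)))
∈-interval {N} -[1+ k ] k<N = ∈-++⁺ʳ (map +_ (upTo (suc N))) (∈-map⁺ (-_ ∘ +_) (∈-upTo⁺ (s≤s k<N)))

infixl 6 _+[_]·_

-- This is p + a·q. It serves both for multiplying by X + a, as X·p + a·p, and, with a = -1, for
-- subtracting polynomials.
_+[_]·_ : ℤ[x] → ℤ → ℤ[x] → ℤ[x]
p       +[ a ]· []      = p
[]      +[ a ]· (d ∷ q) = a * d ∷ ([] +[ a ]· q)
(c ∷ p) +[ a ]· (d ∷ q) = c + a * d ∷ (p +[ a ]· q)

coeff-+· : ∀ p a q k → coeff (p +[ a ]· q) k ≡ coeff p k + a * coeff q k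
coeff-+· p a [] k = lemma (coeff p k) a
  where
  lemma : ∀ c a → c ≡ c + a * 0ℤ
  lemma = solve-∀
coeff-+· []      a (d ∷ q) zero    = sym (+-identityˡ (a * d))
coeff-+· []      a (d ∷ q) (suc k) = coeff-+· [] a q k
coeff-+· (c ∷ p) a (d ∷ q) zero    = refl
coeff-+· (c ∷ p) a (d ∷ q) (suc k) = coeff-+· p a q k

eval-+· : ∀ p a q x → eval (p +[ a ]· q) x ≡ eval p x + a * eval q x
eval-+· p a [] x = lemma (eval p x) a
  where
  lemma : ∀ e a → e ≡ e + a * 0ℤ
  lemma = solve-∀
eval-+· [] a (d ∷ q) x = trans (cong (λ e → a * d + x * e) (eval-+· [] a q x)) (lemma a d x (eval q x))
  where
  lemma : ∀ a d x e → a * d + x * (0ℤ + a * e) ≡ 0ℤ + a * (d + x * e)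
  lemma = solve-∀
eval-+· (c ∷ p) a (d ∷ q) x =
  trans (cong (λ e → c + a * d + x * e) (eval-+· p a q x)) (lemma a c d x (eval p x) (eval q x))
  where
  lemma : ∀ a c d x e e′ → c + a * d + x * (e + a * e′) ≡ c + x * e + a * (d + x * e′)
  lemma = solve-∀

∏[X+_] : ∀ {m} → Vector ℤ m → ℤ[x]
∏[X+_] {zero}  r = 1ℤ ∷ []
-- Prepending `0ℤ` multiplies by X, so this is (X + r₀)·P written as X·P + r₀·P.
∏[X+_] {suc m} r = (0ℤ ∷ ∏[X+ tail r ]) +[ r zero ]· ∏[X+ tail r ]

-- Each linear factor raises the degree by at most one.
coeff-∏[X+] : ∀ {m} (r : Vector ℤ m) k → m < k → coeff ∏[X+ r ] k ≡ 0ℤ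
coeff-∏[X+] {zero}  r (suc k) _   = refl
coeff-∏[X+] {suc m} r (suc k) m<k = begin
  coeff ∏[X+ r ] (suc k)
    ≡⟨ coeff-+· (0ℤ ∷ ∏[X+ tail r ]) (r zero) ∏[X+ tail r ] (suc k) ⟩
  coeff ∏[X+ tail r ] k + r zero * coeff ∏[X+ tail r ] (suc k)
    ≡⟨ cong₂ (λ c c′ → c + r zero * c′)
         (coeff-∏[X+] (tail r) k (s<s⁻¹ m<k))
         (coeff-∏[X+] (tail r) (suc k) (m<n⇒m<1+n (s<s⁻¹ m<k))) ⟩
  0ℤ + r zero * 0ℤ
    ≡⟨ trans (+-identityˡ _) (*-zeroʳ (r zero)) ⟩
  0ℤ ∎

eval-∏[X+] : ∀ {m} (r : Vector ℤ m) x → eval ∏[X+ r ] x ≡ product (λ i → x + r i)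
eval-∏[X+] {zero}  r x = cong (λ c → 1ℤ + c) (*-zeroʳ x)
eval-∏[X+] {suc m} r x = begin
  eval ∏[X+ r ] x
    ≡⟨ eval-+· (0ℤ ∷ ∏[X+ tail r ]) (r zero) ∏[X+ tail r ] x ⟩
  0ℤ + x * eval ∏[X+ tail r ] x + r zero * eval ∏[X+ tail r ] x
    ≡⟨ lemma x (r zero) (eval ∏[X+ tail r ] x) ⟩
  (x + r zero) * eval ∏[X+ tail r ] x
    ≡⟨ cong ((x + r zero) *_) (eval-∏[X+] (tail r) x) ⟩
  product (λ i → x + r i) ∎
  where
  lemma : ∀ x a e → 0ℤ + x * e + a * e ≡ (x + a) * e
  lemma = solve-∀

product-cong : ∀ {m} {u v : Vector ℤ m} → u ≗ v → product u ≡ product v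
product-cong {zero}  u≗v = refl
product-cong {suc m} u≗v = cong₂ _*_ (u≗v zero) (product-cong (u≗v ∘ suc))

-- From c = -(x·e), x divides c, and a divisor of a nonzero integer is at most that integer in
-- absolute value.
root⇒≤∣constant∣ : ∀ {c} x e → c ≢ 0ℤ → c + x * e ≡ 0ℤ → ∣ x ∣ ≤ ∣ c ∣
root⇒≤∣constant∣ {c} x e c≢0 root = ∣⇒≤ {{≢-nonZero c≢0}} (subst (∣ x ∣ ∣_) (sym ∣c∣≡) (m∣m*n ∣ e ∣))
  where
  ∣c∣≡ : ∣ c ∣ ≡ ∣ x ∣ ℕ.* ∣ e ∣
  ∣c∣≡ = begin
    ∣ c ∣           ≡⟨ cong ∣_∣ (inverseˡ-unique c (x * e) root) ⟩
    ∣ - (x * e) ∣   ≡⟨ ∣-i∣≡∣i∣ (x * e) ⟩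
    ∣ x * e ∣       ≡⟨ abs-* x e ⟩
    ∣ x ∣ ℕ.* ∣ e ∣  ∎

-- Factors of X are split off, each contributing the root 0, until a nonzero constant term bounds
-- the remaining roots. The index `k` certifies that such a term is reached, even in a list with
-- trailing zeros.
finitelyManyRoots : ∀ p k → coeff p k ≢ 0ℤ → ∃[ xs ] (∀ x → eval p x ≡ 0ℤ → x ∈ xs)
finitelyManyRoots [] k 0≢0 with () ← 0≢0 refl
finitelyManyRoots (c ∷ p) zero c≢0 =
  interval ∣ c ∣ , λ x root → ∈-interval x (root⇒≤∣constant∣ x (eval p x) c≢0 root)
finitelyManyRoots (c ∷ p) (suc k) pₖ≢0
  with c ≟ 0ℤ | finitelyManyRoots p k pₖ≢0
... | no c≢0   | _ =
  interval ∣ c ∣ , λ x root → ∈-interval x (root⇒≤∣constant∣ x (eval p x) c≢0 root)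
... | yes refl | xs , roots∈xs = 0ℤ ∷ xs , roots∈
  where
  roots∈ : ∀ x → 0ℤ + x * eval p x ≡ 0ℤ → x ∈ 0ℤ ∷ xs
  roots∈ x root with i*j≡0⇒i≡0∨j≡0 x (trans (sym (+-identityˡ _)) root)
  ... | inj₁ x≡0  = here x≡0
  ... | inj₂ px≡0 = there (roots∈xs x px≡0)

-- `Finite` asks for a list with exactly the elements of `P`, so a covering list is filtered by the
-- decision procedure.
⊆-list⇒Finite : ∀ {a ℓ} {A : Set a} {P : Pred A ℓ} → Decidable P →
                ∀ xs → P ⊆ (_∈ xs) → Finite P
⊆-list⇒Finite P? xs P⊆xs =
  filter P? xs , (λ Px → ∈-filter⁺ P? (P⊆xs Px) Px) , (λ x∈ → proj₂ (∈-filter⁻ P? {xs = xs} x∈))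

module _ {m n} (m<n : m < n) (f : ℤ[x]) (fₙ≢0 : coeff f n ≢ 0ℤ) (q : Vector ℤ m) where

  -- Its integer roots are the x-coordinates of the solutions on the line y = x + d.
  difference : ℤ → ℤ[x]
  difference d = f +[ -1ℤ ]· ∏[X+ (λ i → d + q i) ]

  coeff-difference : ∀ d → coeff (difference d) n ≡ coeff f n
  coeff-difference d = begin
    coeff (difference d) n
      ≡⟨ coeff-+· f -1ℤ ∏[X+ (λ i → d + q i) ] n ⟩
    coeff f n + -1ℤ * coeff ∏[X+ (λ i → d + q i) ] n
      ≡⟨ cong (λ c → coeff f n + -1ℤ * c) (coeff-∏[X+] (λ i → d + q i) n m<n) ⟩
    coeff f n + 0ℤ
      ≡⟨ +-identityʳ (coeff f n) ⟩
    coeff f n ∎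

  -- For d = y - x every factor x + (d + qᵢ) is y + qᵢ, so the subtracted product takes the value
  -- f(x).
  solution⇒root : ∀ x y → Solution q f (x , y) → eval (difference (y - x)) x ≡ 0ℤ
  solution⇒root x y sol = begin
    eval (difference (y - x)) x
      ≡⟨ eval-+· f -1ℤ ∏[X+ (λ i → (y - x) + q i) ] x ⟩
    eval f x + -1ℤ * eval ∏[X+ (λ i → (y - x) + q i) ] x
      ≡⟨ cong (λ e → eval f x + -1ℤ * e) (begin
           eval ∏[X+ (λ i → (y - x) + q i) ] x    ≡⟨ eval-∏[X+] (λ i → (y - x) + q i) x ⟩
           product (λ i → x + ((y - x) + q i))    ≡⟨ product-cong (λ i → shift x y (q i)) ⟩
           product (λ i → y + q i)                ≡⟨ sol ⟩
           eval f x                               ∎) ⟩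
    eval f x + -1ℤ * eval f x
      ≡⟨ cancel (eval f x) ⟩
    0ℤ ∎
    where
    shift : ∀ x y a → x + ((y - x) + a) ≡ y + a
    shift = solve-∀
    cancel : ∀ e → e + -1ℤ * e ≡ 0ℤ
    cancel = solve-∀

  roots : ∀ d → ∃[ xs ] (∀ x → eval (difference d) x ≡ 0ℤ → x ∈ xs)
  roots d = finitelyManyRoots (difference d) n (fₙ≢0 ∘ trans (sym (coeff-difference d)))

  bounded⇒finite : ∃[ C ] (∀ x y → Solution q f (x , y) → ∣ x - y ∣ ≤ C) → Finite (Solution q f)
  bounded⇒finite (C , bound) =
    ⊆-list⇒Finite (λ (x , y) → product (λ i → y + q i) ≟ eval f x)
      (concatMap line (interval C)) (λ {(x , y)} → covered x y)
    where
    -- Candidates with y - x = d. Some may fail the equation, since the root lists only cover the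
    -- roots; filtering removes them.
    line : ℤ → List (ℤ × ℤ)
    line d = map (λ x → x , x + d) (proj₁ (roots d))

    x+[y-x]≡y : ∀ x y → x + (y - x) ≡ y
    x+[y-x]≡y = solve-∀

    covered : ∀ x y → Solution q f (x , y) → (x , y) ∈ concatMap line (interval C)
    covered x y sol = ∈-concatMap⁺ line (lose
      (∈-interval (y - x) (subst (_≤ C) (∣i-j∣≡∣j-i∣ x y) (bound x y sol)))
      (subst (λ z → (x , z) ∈ line (y - x)) (x+[y-x]≡y x y)
        (∈-map⁺ _ (proj₂ (roots (y - x)) x (solution⇒root x y sol)))))

finite⇒bounded : ∀ {ℓ} {P : Pred (ℤ × ℤ) ℓ} → Finite P → ∃[ C ] (∀ x y → P (x , y) → ∣ x - y ∣ ≤ C)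
finite⇒bounded (ps , P⊆ps , _) =
  -- The bound is the largest distance in the list, with `0` as the value for an empty list.
  max 0 (map dist ps) , λ x y Pxy → lookup (xs≤max 0 (map dist ps)) (∈-map⁺ dist (P⊆ps Pxy))
  where
  dist : ℤ × ℤ → ℕ
  dist (x , y) = ∣ x - y ∣

theorem1p1 : (m n : ℕ) → 0 < m → m < n →
    (f : ℤ[x]) → Monic f → HasDegree f n →
    (q : Vector ℤ m) →
    Finite (Solution q f) ⇔
    (∃[ C ] (∀ (x y : ℤ) → Solution q f (x , y) → ∣ x - y ∣ ≤ C))
theorem1p1 m n _ m<n f _ (fₙ≢0 , _) q =
  mk⇔ finite⇒bounded (bounded⇒finite m<n f fₙ≢0 q)
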